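{- Let $m,n$ be integers with $n\ge3$ and $p:=m-n\ge1$. Let $G$ be the graph whose vertices are the maps $f:[n]\to[m]$ that are either constant or injective, with $f\sim f'$ iff $f(i)\ne f'(j)$ for all $i\ne j$ in $[n]$. Then $H_p(\mathcal N(G);\mathbb Z_2)\neq 0$.
   Context: $[k]=\{1,\dots,k\}$. The graph $G$ is the induced subgraph of the exponential graph $K_m^{K_n}$ on the constant and injective maps (injective maps carry loops). The neighbourhood complex $\mathcal N(G)$ is the simplicial complex whose simplices are the nonempty sets of vertices of $G$ having a common neighbour in $G$; $H_p(\cdot;\mathbb Z_2)$ denotes simplicial (equivalently singular) homology with $\mathbb Z_2$ coefficients. -}

module Defs where

open import Data.Nat using (ℕ; zero; suc; _≡ᵇ_)
open import Data.Bool using (Bool; true; false; _∧_; _xor_; T)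
open import Data.Fin using (Fin)
open import Data.Vec using (Vec; []; _∷_; lookup)
open import Data.List using (List; map; foldr; _++_) renaming ([] to []ₗ; _∷_ to _∷ₗ_)
open import Data.Fin.Subset using (Subset; inside; outside; _∈_; _⊆_; ∣_∣; Nonempty)
open import Data.Fin.Subset.Properties using (_⊆?_)
open import Data.Product using (Σ; ∃; _×_)
open import Relation.Nullary using (¬_)
open import Relation.Nullary.Decidable using (⌊_⌋)
open import Relation.Binary.PropositionalEquality using (_≡_; _≢_)

IsConstant : ∀ {m n} → Vec (Fin m) n → Set
IsConstant {m} {n} f = ∀ (i j : Fin n) → lookup f i ≡ lookup f j

IsInjective : ∀ {m n} → Vec (Fin m) n → Set
IsInjective {m} {n} f = ∀ (i j : Fin n) → lookup f i ≡ lookup f j → i ≡ j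

IsVertexG : ∀ {m n} → Vec (Fin m) n → Set
IsVertexG f = IsConstant f Data.Sum.⊎ IsInjective f
  where import Data.Sum

-- adjacency in G (equivalently in K_m^{K_n}): f ~ f' iff f(i) ≠ f'(j) for all i ≠ j
AdjG : ∀ {m n} → Vec (Fin m) n → Vec (Fin m) n → Set
AdjG {m} {n} f f' = ∀ (i j : Fin n) → i ≢ j → lookup f i ≢ lookup f' j

IsVertexEnumeration : ∀ {m n} (N : ℕ) → (Fin N → Vec (Fin m) n) → Set
IsVertexEnumeration {m} {n} N e =
  (∀ (a b : Fin N) → e a ≡ e b → a ≡ b) ×
  (∀ (a : Fin N) → IsVertexG (e a)) ×
  (∀ (f : Vec (Fin m) n) → IsVertexG f → ∃ λ (a : Fin N) → e a ≡ f)

IsNbhdSimplex : ∀ {N} → (Fin N → Fin N → Set) → Subset N → Set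
IsNbhdSimplex {N} adj σ = Nonempty σ × ∃ λ (w : Fin N) → ∀ (v : Fin N) → v ∈ σ → adj v w

allSubsets : ∀ N → List (Subset N)
allSubsets zero = [] ∷ₗ []ₗ
allSubsets (suc N) = map (inside ∷_) (allSubsets N) ++ map (outside ∷_) (allSubsets N)

sumZ₂ : ∀ {N} → (Subset N → Bool) → Bool
sumZ₂ {N} g = foldr _xor_ false (map g (allSubsets N))

isFacet : ∀ {N} → Subset N → Subset N → Bool
isFacet τ σ = ⌊ τ ⊆? σ ⌋ ∧ (∣ σ ∣ ≡ᵇ suc ∣ τ ∣)

IsChain : ∀ {N} → (Subset N → Set) → ℕ → (Subset N → Bool) → Set
IsChain {N} K p c = ∀ (σ : Subset N) → T (c σ) → K σ × ∣ σ ∣ ≡ suc p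

boundary : ∀ {N} → (Subset N → Bool) → Subset N → Bool
boundary c τ = sumZ₂ (λ σ → c σ ∧ isFacet τ σ)

-- cycle: boundary vanishes on every (nonempty) simplex (unreduced homology)
IsCycle : ∀ {N} → (Subset N → Bool) → Set
IsCycle {N} c = ∀ (τ : Subset N) → Nonempty τ → boundary c τ ≡ false

IsBoundary : ∀ {N} → (Subset N → Set) → ℕ → (Subset N → Bool) → Set
IsBoundary {N} K p c =
  ∃ λ (d : Subset N → Bool) → IsChain K (suc p) d × (∀ (σ : Subset N) → boundary d σ ≡ c σ)

HomologyNonzero : ∀ {N} → (Subset N → Set) → ℕ → Set
HomologyNonzero K p =
  ∃ λ c → IsChain K p c × IsCycle c × ¬ IsBoundary K p c

{-# OPTIONS --safe #-}
module Submission where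

-- List the vertices of a simplex σ as the rows of a matrix with n columns and let φ(σ) be the
-- number mod 2 of monotone lattice paths, from the top-left to the bottom-right entry, whose
-- entries are the elements of [m], each exactly once.  On 𝒩(G) this is a p-cocycle: for a list of
-- m + 1 elements of [m] the number of entries whose deletion leaves a permutation of [m] is even,
-- and deleting single entries from the paths of a matrix amounts mod 2 to deleting rows and
-- deleting columns; a matrix without column j does not contain the value g(j) of a common
-- neighbour g.  With f injective and B consisting of one value of f and all values outside the
-- image of f, the proper faces of {f} ∪ B (B read as constant maps) lie in 𝒩(G), and of the facets
-- only the one without the constant shared with f has φ ≠ 0, so φ is 1 on this p-cycle.

open import Defs
open import Algebra.Bundles using (CommutativeRing)
open import Data.Bool using (Bool; true; false; not; _∧_; _xor_)
open import Data.Bool.Properties using (xor-same; xor-comm; xor-identityʳ; not-distribˡ-xor; ∧-zeroʳ; ∧-comm; ∧-identityʳ; xor-∧-commutativeRing; T-≡)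
open import Data.Bool.Solver using (module xor-∧-Solver)
open import Data.Fin using (Fin; zero; suc; _≟_; punchIn; _↑ˡ_; _↑ʳ_; splitAt)
open import Data.Fin.Properties using (punchInᵢ≢i; suc-injective; ↑ˡ-injective; ↑ʳ-injective; splitAt-↑ˡ; splitAt-↑ʳ; splitAt⁻¹-↑ˡ; splitAt⁻¹-↑ʳ)
open import Data.Fin.Subset using (Subset; ∣_∣; ⊤; ⊥)
open import Data.Fin.Subset.Properties using (_⊆?_; p⊆q⇒∣p∣≤∣q∣; ∣⊤∣≡n; ∣⊥∣≡0)
open import Data.List using (List; []; _∷_; map; _++_; length; foldr)
open import Data.List.Membership.Propositional using (_∈_)
open import Data.List.Membership.Propositional.Properties using (∈-++⁺ˡ; ∈-++⁺ʳ; ∈-++⁻; ∈-map⁻)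
open import Data.List.Properties using (map-∘; map-++; map-cong; length-++; length-map)
open import Data.List.Relation.Unary.All as All using (All; []; _∷_)
import Data.List.Relation.Unary.All.Properties as All
open import Data.List.Relation.Unary.Any using (here; there)
open import Data.Nat using (ℕ; zero; suc; _+_; _∸_; _≤_; _<_; s≤s; _≡ᵇ_)
import Data.Nat.Properties as ℕ
open import Data.Product using (∃; _×_; _,_; proj₁; proj₂)
open import Data.Sum using (inj₁; inj₂)
open import Data.Vec using (Vec; []; _∷_; head; tail; removeAt; lookup; _[_]≔_; replicate; toList; tabulate)
open import Data.Vec.Membership.Propositional.Properties using (∈-lookup; ∈-toList⁺)
open import Data.Vec.Properties using (lookup∘update; lookup∘update′; []≔-idempotent; []≔-commutes; []≔-lookup; lookup-replicate; lookup∘tabulate; length-toList; []=⇒lookup; lookup⇒[]=)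
open import Function using (_∘_)
open import Function.Bundles using (Equivalence)
open import Relation.Nullary using (¬_; yes; no; contradiction)
open import Relation.Nullary.Decidable using (⌊_⌋; isYes≗does)
open import Relation.Binary.PropositionalEquality
open import Algebra.Properties.CommutativeMonoid.Sum (CommutativeRing.+-commutativeMonoid xor-∧-commutativeRing) using (sum; sum-cong-≗; ∑-distrib-+; sum-replicate-zero; sum-remove)
open xor-∧-Solver using (solve; _:=_; _:+_; con)

private variable
  A B : Set
  m n N M : ℕ

-- Sums mod 2 over the deletions of one list entry.

sum-false : (f : Fin n → Bool) → (∀ i → f i ≡ false) → sum f ≡ false
sum-false {n} f f≡0 = trans (sum-cong-≗ f≡0) (sum-replicate-zero n)

∑-delete : (List A → Bool) → List A → Bool
∑-delete F []      = false
∑-delete F (x ∷ L) = F L xor ∑-delete (F ∘ (x ∷_)) L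

∑-delete-cong : {F G : List A → Bool} → (∀ L → F L ≡ G L) → ∀ L → ∑-delete F L ≡ ∑-delete G L
∑-delete-cong F≡G []      = refl
∑-delete-cong F≡G (x ∷ L) = cong₂ _xor_ (F≡G L) (∑-delete-cong (F≡G ∘ (x ∷_)) L)

∑-delete-false : (L : List A) → ∑-delete (λ _ → false) L ≡ false
∑-delete-false []      = refl
∑-delete-false (x ∷ L) = ∑-delete-false L

xor-interchange : ∀ a b c d → (a xor b) xor (c xor d) ≡ (a xor c) xor (b xor d)
xor-interchange = solve 4 (λ a b c d → (a :+ b) :+ (c :+ d) := (a :+ c) :+ (b :+ d)) refl

∑-delete-xor : (F G : List A → Bool) → ∀ L →
  ∑-delete (λ L → F L xor G L) L ≡ ∑-delete F L xor ∑-delete G L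
∑-delete-xor F G []      = refl
∑-delete-xor F G (x ∷ L) = trans
  (cong ((F L xor G L) xor_) (∑-delete-xor (F ∘ (x ∷_)) (G ∘ (x ∷_)) L))
  (xor-interchange (F L) (G L) _ _)

∑-delete-map : (f : A → B) (F : List B → Bool) → ∀ L → ∑-delete F (map f L) ≡ ∑-delete (F ∘ map f) L
∑-delete-map f F []      = refl
∑-delete-map f F (x ∷ L) = cong (F (map f L) xor_) (∑-delete-map f (F ∘ (f x ∷_)) L)

-- Lattice paths in a matrix; deletion of entries, rows and columns.

-- The contribution of a path that ends in its first entry, where c counts the remaining columns.
corner : ℕ → List A → Bool → Bool
corner zero    []      b = b
corner zero    (_ ∷ _) b = false
corner (suc _) _       b = false

-- The sum of F over the entry lists of the monotone lattice paths from the top-left to the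
-- bottom-right entry of the matrix with the given rows.
∑-path : ∀ c → List (Vec A c) → (List A → Bool) → Bool
∑-path zero    _       F = false
∑-path (suc c) []      F = false
∑-path (suc c) (r ∷ R) F =
  corner c R (F (head r ∷ [])) xor
  (∑-path (suc c) R (F ∘ (head r ∷_)) xor ∑-path c (map tail (r ∷ R)) (F ∘ (head r ∷_)))

∑-path-[] : ∀ c (F : List A → Bool) → ∑-path c [] F ≡ false
∑-path-[] zero    F = refl
∑-path-[] (suc c) F = refl

corner-xor : ∀ c (R : List A) a b → corner c R (a xor b) ≡ corner c R a xor corner c R b
corner-xor zero    []      a b = refl
corner-xor zero    (_ ∷ _) a b = refl
corner-xor (suc c) R       a b = refl

∑-path-cong : ∀ c (R : List (Vec A c)) {F G : List A → Bool} → (∀ L → F L ≡ G L) → ∑-path c R F ≡ ∑-path c R G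
∑-path-cong zero    R       F≡G = refl
∑-path-cong (suc c) []      F≡G = refl
∑-path-cong (suc c) (r ∷ R) F≡G = cong₂ _xor_ (cong (corner c R) (F≡G _))
  (cong₂ _xor_ (∑-path-cong (suc c) R (F≡G ∘ (head r ∷_)))
               (∑-path-cong c (map tail (r ∷ R)) (F≡G ∘ (head r ∷_))))

∑-path-xor : ∀ c (R : List (Vec A c)) (F G : List A → Bool) →
  ∑-path c R (λ L → F L xor G L) ≡ ∑-path c R F xor ∑-path c R G
∑-path-xor zero    R       F G = refl
∑-path-xor (suc c) []      F G = refl
∑-path-xor (suc c) (r ∷ R) F G = trans
  (cong₂ _xor_ (corner-xor c R _ _)
    (trans (cong₂ _xor_ (∑-path-xor (suc c) R (F ∘ (head r ∷_)) (G ∘ (head r ∷_)))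
                        (∑-path-xor c (map tail (r ∷ R)) (F ∘ (head r ∷_)) (G ∘ (head r ∷_))))
           (xor-interchange (∑-path (suc c) R _) _ _ _)))
  (xor-interchange (corner c R _) _ _ _)

-- The correction term for a matrix with one row and one column: deleting its only entry leaves the
-- empty list, whereas the matrix without its row or without its column has no paths at all.
single : ℕ → List A → Bool → Bool
single c []      b = false
single c (_ ∷ R) b = corner c R b

single-suc : ∀ c (R : List A) b → single (suc c) R b ≡ false
single-suc c []      b = refl
single-suc c (_ ∷ R) b = refl

-- Deleting one entry leaves the empty list only if there is exactly one entry.
∑-delete-corner : ∀ (R : List A) b → ∑-delete (λ X → corner zero X b) R ≡ single zero R b
∑-delete-corner []          b = refl
∑-delete-corner (x ∷ [])    b = xor-identityʳ b
∑-delete-corner (x ∷ y ∷ R) b = ∑-delete-false (y ∷ R)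

removeColumn : Fin (suc n) → List (Vec A (suc n)) → List (Vec A n)
removeColumn j = map (λ r → removeAt r j)

∑-column : ∀ c → List (Vec A (suc c)) → (List A → Bool) → Bool
∑-column c R F = sum (λ j → ∑-path c (removeColumn j R) F)

corner-map : ∀ c (f : A → B) R b → corner c (map f R) b ≡ corner c R b
corner-map zero    f []      b = refl
corner-map zero    f (_ ∷ _) b = refl
corner-map (suc c) f R       b = refl

-- Nonzero terms occur only for `c = 0`, where the sum has a single term, so the parity of `suc c`
-- does not enter.
sum-corner : ∀ c (R : List A) b → sum {suc c} (λ _ → corner c R b) ≡ corner c R b
sum-corner zero    []      b = xor-identityʳ b
sum-corner zero    (_ ∷ _) b = refl
sum-corner (suc c) R       b = sum-false {suc (suc c)} (λ _ → false) (λ _ → refl)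

removeAt-zero : (r : Vec A (suc n)) → removeAt r zero ≡ tail r
removeAt-zero (x ∷ r) = refl

tail-removeAt : (j : Fin (suc n)) (r : Vec A (suc (suc n))) → tail (removeAt r (suc j)) ≡ removeAt (tail r) j
tail-removeAt j (x ∷ y ∷ r) = refl

removeColumn-zero : (R : List (Vec A (suc n))) → removeColumn zero R ≡ map tail R
removeColumn-zero []      = refl
removeColumn-zero (r ∷ R) = cong₂ _∷_ (removeAt-zero r) (removeColumn-zero R)

tail-removeColumn : (j : Fin (suc n)) (R : List (Vec A (suc (suc n)))) →
  map tail (removeColumn (suc j) R) ≡ removeColumn j (map tail R)
tail-removeColumn j []      = refl
tail-removeColumn j (r ∷ R) = cong₂ _∷_ (tail-removeAt j r) (tail-removeColumn j R)

-- Deleting an entry of a path in the interior of a vertical (horizontal) run leaves a path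
-- of the matrix without its row (column); deleting a turn leaves a diagonal step, which
-- arises from exactly two paths, so these terms cancel mod 2.
∑-path-delete : ∀ c (R : List (Vec A (suc c))) (F : List A → Bool) →
  ∑-path (suc c) R (∑-delete F) ≡
  ∑-delete (λ X → ∑-path (suc c) X F) R xor (∑-column c R F xor single c R (F []))
∑-path-delete c [] F = sym (trans (xor-identityʳ _) (sum-false {suc c} _ (λ j → ∑-path-[] c F)))
∑-path-delete zero ((a ∷ []) ∷ R) F = begin
  corner zero R (F [] xor false) xor (∑-path 1 R (λ L → F L xor ∑-delete Fa L) xor false)
    ≡⟨ cong₂ _xor_ (cong (corner zero R) (xor-identityʳ _)) (xor-identityʳ _) ⟩
  corner zero R (F []) xor ∑-path 1 R (λ L → F L xor ∑-delete Fa L)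
    ≡⟨ cong (corner zero R (F []) xor_) (trans (∑-path-xor 1 R F (∑-delete Fa))
        (cong (∑-path 1 R F xor_) (∑-path-delete zero R Fa))) ⟩
  corner zero R (F []) xor (∑-path 1 R F xor
    (∑-delete (λ X → ∑-path 1 X Fa) R xor (false xor single zero R (Fa []))))
    ≡⟨ solve 4 (λ u p d s → u :+ (p :+ (d :+ (con false :+ s))) := (p :+ (s :+ d)) :+ (con false :+ u)) refl
        (corner zero R (F [])) (∑-path 1 R F) (∑-delete (λ X → ∑-path 1 X Fa) R) (single zero R (Fa [])) ⟩
  (∑-path 1 R F xor (single zero R (Fa []) xor ∑-delete (λ X → ∑-path 1 X Fa) R)) xor (false xor corner zero R (F []))
    ≡⟨ cong (λ t → (∑-path 1 R F xor t) xor (false xor corner zero R (F []))) (sym (begin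
        ∑-delete (λ X → corner zero X (Fa []) xor (∑-path 1 X Fa xor false)) R
          ≡⟨ ∑-delete-xor (λ X → corner zero X (Fa [])) _ R ⟩
        ∑-delete (λ X → corner zero X (Fa [])) R xor ∑-delete (λ X → ∑-path 1 X Fa xor false) R
          ≡⟨ cong₂ _xor_ (∑-delete-corner R (Fa [])) (∑-delete-cong (λ X → xor-identityʳ _) R) ⟩
        single zero R (Fa []) xor ∑-delete (λ X → ∑-path 1 X Fa) R ∎)) ⟩
  (∑-path 1 R F xor ∑-delete (λ X → ∑-path 1 ((a ∷ []) ∷ X) F) R) xor (false xor corner zero R (F [])) ∎
  where
  open ≡-Reasoning
  Fa = F ∘ (a ∷_)
∑-path-delete {A = A} (suc c) ((a ∷ r) ∷ R) F = begin
  ∑-path (suc (suc c)) R (λ L → F L xor ∑-delete Fa L) xor ∑-path (suc c) tR (λ L → F L xor ∑-delete Fa L)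
    ≡⟨ cong₂ _xor_
        (trans (∑-path-xor (suc (suc c)) R F (∑-delete Fa)) (cong (pRF xor_) (∑-path-delete (suc c) R Fa)))
        (trans (∑-path-xor (suc c) tR F (∑-delete Fa)) (cong (pTF xor_) (∑-path-delete c tR Fa))) ⟩
  (pRF xor (dR xor (∑-column (suc c) R Fa xor single (suc c) R (Fa [])))) xor
  (pTF xor ((pTR xor ∑-delete (λ X → ∑-path (suc c) (r ∷ X) Fa) (map tail R)) xor (cT xor u)))
    ≡⟨ cong₂ (λ s t → (pRF xor (dR xor s)) xor (pTF xor ((pTR xor t) xor (cT xor u))))
        (trans (cong₂ _xor_ col (single-suc c R (Fa []))) (xor-identityʳ _))
        (∑-delete-map tail _ R) ⟩
  (pRF xor (dR xor (pTR xor cR))) xor (pTF xor ((pTR xor dT) xor (cT xor u)))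
    -- The two copies of `pTR` cancel. Both stand for a diagonal step from `a`: one comes from
    -- stepping down and then right, the other from stepping right and then down, with the turn
    -- deleted.
    ≡⟨ solve 8 (λ pRF dR pTR cR pTF dT cT u →
         (pRF :+ (dR :+ (pTR :+ cR))) :+ (pTF :+ ((pTR :+ dT) :+ (cT :+ u))) :=
         (pRF :+ (dR :+ dT)) :+ ((pTF :+ (u :+ (cR :+ cT))) :+ con false)) refl
         pRF dR pTR cR pTF dT cT u ⟩
  (pRF xor (dR xor dT)) xor ((pTF xor (u xor (cR xor cT))) xor false)
    ≡⟨ cong₂ (λ s t → (pRF xor s) xor (t xor false)) (sym (∑-delete-xor (λ X → ∑-path (suc (suc c)) X Fa) _ R)) (sym cols) ⟩
  (pRF xor ∑-delete (λ X → ∑-path (suc (suc c)) ((a ∷ r) ∷ X) F) R) xor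
  (∑-column (suc c) ((a ∷ r) ∷ R) F xor single (suc c) ((a ∷ r) ∷ R) (F [])) ∎
  where
  open ≡-Reasoning
  Fa = F ∘ (a ∷_)
  tR = r ∷ map tail R
  pRF = ∑-path (suc (suc c)) R F
  pTF = ∑-path (suc c) tR F
  dR = ∑-delete (λ X → ∑-path (suc (suc c)) X Fa) R
  pTR = ∑-path (suc c) (map tail R) Fa
  cR = sum (λ j → ∑-path (suc c) (removeColumn (suc j) R) Fa)
  cT = ∑-column c tR Fa
  u = corner c (map tail R) (Fa [])
  dT = ∑-delete (λ X → ∑-path (suc c) (r ∷ map tail X) Fa) R
  col : ∑-column (suc c) R Fa ≡ pTR xor cR
  col = cong (λ X → ∑-path (suc c) X Fa xor cR) (removeColumn-zero R)
  colⱼ : ∀ r j → ∑-path (suc c) (removeColumn (suc j) ((a ∷ r) ∷ R)) F ≡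
    corner c R (Fa []) xor (∑-path (suc c) (removeColumn (suc j) R) Fa xor ∑-path c (removeColumn j (r ∷ map tail R)) Fa)
  colⱼ (b ∷ r) j = cong₂ _xor_ (corner-map c _ R _)
    (cong (λ X → ∑-path (suc c) (removeColumn (suc j) R) Fa xor ∑-path c (removeAt (b ∷ r) j ∷ X) Fa) (tail-removeColumn j R))
  cols : ∑-column (suc c) ((a ∷ r) ∷ R) F ≡ pTF xor (u xor (cR xor cT))
  cols = cong₂ _xor_ (cong (λ X → ∑-path (suc c) (r ∷ X) F) (removeColumn-zero R)) (begin
    sum (λ j → ∑-path (suc c) (removeColumn (suc j) ((a ∷ r) ∷ R)) F)
      ≡⟨ sum-cong-≗ (colⱼ r) ⟩
    sum (λ j → corner c R (Fa []) xor (∑-path (suc c) (removeColumn (suc j) R) Fa xor ∑-path c (removeColumn j tR) Fa))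
      ≡⟨ ∑-distrib-+ (λ _ → corner c R (Fa [])) (λ j → ∑-path (suc c) (removeColumn (suc j) R) Fa xor ∑-path c (removeColumn j tR) Fa) ⟩
    sum {suc c} (λ _ → corner c R (Fa [])) xor sum (λ j → ∑-path (suc c) (removeColumn (suc j) R) Fa xor ∑-path c (removeColumn j tR) Fa)
      ≡⟨ cong₂ _xor_ (trans (sum-corner c R _) (sym (corner-map c tail R _)))
          (∑-distrib-+ (λ j → ∑-path (suc c) (removeColumn (suc j) R) Fa) (λ j → ∑-path c (removeColumn j tR) Fa)) ⟩
    u xor (cR xor cT) ∎)

-- Lists that meet each element of a set exactly once.

isEmpty : Subset m → Bool
isEmpty []      = true
isEmpty (b ∷ S) = not b ∧ isEmpty S

-- The subset holds the values still to be met. Thus `exhausts ⊤` tests for a permutation of `[m]`,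
-- and a repeated entry fails because its value has been removed.
exhausts : Subset m → List (Fin m) → Bool
exhausts S []      = isEmpty S
exhausts S (x ∷ L) = lookup S x ∧ exhausts (S [ x ]≔ false) L

-- Away from `x` equal terms cancel mod 2.
sum-differ : (f g : Fin n → Bool) (x : Fin n) → (∀ k → k ≢ x → f k ≡ g k) → sum f xor sum g ≡ f x xor g x
sum-differ {n = suc n} f g x f≡g = begin
  sum f xor sum g                                              ≡⟨ cong₂ _xor_ (sum-remove f) (sum-remove g) ⟩
  (f x xor sum (f ∘ punchIn x)) xor (g x xor sum (g ∘ punchIn x))
    ≡⟨ cong (λ t → (f x xor t) xor (g x xor sum (g ∘ punchIn x))) (sum-cong-≗ (λ k → f≡g _ (punchInᵢ≢i x k))) ⟩
  (f x xor sum (g ∘ punchIn x)) xor (g x xor sum (g ∘ punchIn x))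
    ≡⟨ solve 3 (λ a b s → (a :+ s) :+ (b :+ s) := a :+ b) refl (f x) (g x) (sum (g ∘ punchIn x)) ⟩
  f x xor g x ∎
  where open ≡-Reasoning

sum-single : (f : Fin n → Bool) (x : Fin n) → (∀ k → k ≢ x → f k ≡ false) → sum f ≡ f x
sum-single {n = n} f x f≡0 = trans (sym (trans (cong (sum f xor_) (sum-false {n} (λ _ → false) (λ _ → refl))) (xor-identityʳ _)))
  (trans (sum-differ f (λ _ → false) x f≡0) (xor-identityʳ _))

restore : (S : Subset m) (x : Fin m) {a b : Bool} → lookup S x ≡ b → (S [ x ]≔ a) [ x ]≔ b ≡ S
restore S x refl = trans ([]≔-idempotent S x) ([]≔-lookup S x)

-- Suppose that deleting an entry `k` leaves an enumeration of `S`. If `k` lies in `S`, then `k`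
-- stands at exactly two places of `L`, and the two deletions cancel. Otherwise `L` enumerates `S`
-- together with `k`, and `k` can be deleted at one place only.
∑-delete-exhausts : ∀ (S : Subset m) L →
  ∑-delete (exhausts S) L ≡ sum (λ k → not (lookup S k) ∧ exhausts (S [ k ]≔ true) L)
∑-delete-exhausts S [] = sym (sum-false _ nonempty)
  where
  isEmpty-update : ∀ {m} (S : Subset m) k → isEmpty (S [ k ]≔ true) ≡ false
  isEmpty-update (b ∷ S) zero    = refl
  isEmpty-update (b ∷ S) (suc k) = trans (cong (not b ∧_) (isEmpty-update S k)) (∧-zeroʳ _)
  nonempty : ∀ k → not (lookup S k) ∧ isEmpty (S [ k ]≔ true) ≡ false
  nonempty k = trans (cong (not (lookup S k) ∧_) (isEmpty-update S k)) (∧-zeroʳ _)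
∑-delete-exhausts S (x ∷ L) with lookup S x in Sx
... | true = begin
  exhausts S L xor ∑-delete (exhausts (S [ x ]≔ false)) L
    ≡⟨ cong (exhausts S L xor_) (∑-delete-exhausts (S [ x ]≔ false) L) ⟩
  exhausts S L xor sum f
    ≡⟨ solve 3 (λ e f g → e :+ f := (e :+ (f :+ g)) :+ g) refl (exhausts S L) (sum f) (sum g) ⟩
  (exhausts S L xor (sum f xor sum g)) xor sum g
    -- The term `f x` accounts for a second occurrence of `x`, in `L`; it cancels the deletion of
    -- the first one.
    ≡⟨ cong (λ t → (exhausts S L xor t) xor sum g) (trans (sum-differ f g x f≡g) (trans (cong₂ _xor_ fx gx) (xor-identityʳ _))) ⟩
  (exhausts S L xor exhausts S L) xor sum g
    ≡⟨ cong (_xor sum g) (xor-same (exhausts S L)) ⟩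
  sum g ∎
  where
  open ≡-Reasoning
  f g : Fin _ → Bool
  f k = not (lookup (S [ x ]≔ false) k) ∧ exhausts ((S [ x ]≔ false) [ k ]≔ true) L
  g k = not (lookup S k) ∧ (lookup (S [ k ]≔ true) x ∧ exhausts ((S [ k ]≔ true) [ x ]≔ false) L)
  f≡g : ∀ k → k ≢ x → f k ≡ g k
  f≡g k k≢x = cong₂ (λ a b → not a ∧ b) (lookup∘update′ k≢x S false)
    (trans (cong (λ S → exhausts S L) ([]≔-commutes S x k (k≢x ∘ sym)))
           (cong (_∧ exhausts ((S [ k ]≔ true) [ x ]≔ false) L)
             (sym (trans (lookup∘update′ (k≢x ∘ sym) S true) Sx))))
  fx : f x ≡ exhausts S L
  fx = cong₂ (λ a b → not a ∧ b) (lookup∘update x S false) (cong (λ S → exhausts S L) (restore S x Sx))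
  gx : g x ≡ false
  gx = cong (λ a → not a ∧ (lookup (S [ x ]≔ true) x ∧ exhausts ((S [ x ]≔ true) [ x ]≔ false) L)) Sx
-- With `x` outside `S`, only the deletion of `x` itself counts on the left, and only `k = x` on the
-- right.
... | false = begin
  exhausts S L xor ∑-delete (λ _ → false) L
    ≡⟨ trans (cong (exhausts S L xor_) (∑-delete-false L)) (xor-identityʳ _) ⟩
  exhausts S L
    ≡⟨ sym (trans (sum-single g x g≡0) gx) ⟩
  sum g ∎
  where
  open ≡-Reasoning
  g : Fin _ → Bool
  g k = not (lookup S k) ∧ (lookup (S [ k ]≔ true) x ∧ exhausts ((S [ k ]≔ true) [ x ]≔ false) L)
  g≡0 : ∀ k → k ≢ x → g k ≡ false
  g≡0 k k≢x = trans
    (cong (λ a → not (lookup S k) ∧ (a ∧ exhausts ((S [ k ]≔ true) [ x ]≔ false) L)) (trans (lookup∘update′ (k≢x ∘ sym) S true) Sx))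
    (∧-zeroʳ _)
  gx : g x ≡ exhausts S L
  gx = cong₂ (λ a b → not a ∧ b) Sx
    (cong₂ _∧_ (lookup∘update x S true) (cong (λ S → exhausts S L) (restore S x Sx)))

-- No value lies outside `⊤`, so every term of the sum over added values is zero.
∑-delete-exhausts-⊤ : (L : List (Fin m)) → ∑-delete (exhausts ⊤) L ≡ false
∑-delete-exhausts-⊤ L = trans (∑-delete-exhausts ⊤ L)
  (sum-false _ (λ k → cong (λ b → not b ∧ exhausts (⊤ [ k ]≔ true) L) (lookup-replicate k true)))

exhausts-missing : (S : Subset m) {k : Fin m} → lookup S k ≡ true → ∀ L → All (k ≢_) L → exhausts S L ≡ false
exhausts-missing S {k} Sk [] [] = isEmpty-lookup S k Sk
  where
  isEmpty-lookup : ∀ {m} (S : Subset m) k → lookup S k ≡ true → isEmpty S ≡ false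
  isEmpty-lookup (b ∷ S) zero    refl = refl
  isEmpty-lookup (b ∷ S) (suc k) Sk   = trans (cong (not b ∧_) (isEmpty-lookup S k Sk)) (∧-zeroʳ _)
exhausts-missing S Sk (x ∷ L) (k≢x ∷ k∉L) = trans
  (cong (lookup S x ∧_) (exhausts-missing (S [ x ]≔ false) (trans (lookup∘update′ k≢x S false) Sk) L k∉L))
  (∧-zeroʳ _)

∣-∣-update : (S : Subset m) (x : Fin m) → lookup S x ≡ false → ∣ S [ x ]≔ true ∣ ≡ suc ∣ S ∣
∣-∣-update (false ∷ S) zero    refl = refl
∣-∣-update (true  ∷ S) (suc x) Sx   = cong suc (∣-∣-update S x Sx)
∣-∣-update (false ∷ S) (suc x) Sx   = ∣-∣-update S x Sx

∣-∣-delete : (S : Subset m) (x : Fin m) → lookup S x ≡ true → ∣ S ∣ ≡ suc ∣ S [ x ]≔ false ∣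
∣-∣-delete S x Sx = trans (cong ∣_∣ (sym (restore S x Sx)))
  (∣-∣-update (S [ x ]≔ false) x (lookup∘update x S false))

_CoveredBy_ : Subset m → List (Fin m) → Set
S CoveredBy L = ∀ k → lookup S k ≡ true → k ∈ L

covered-tail : (S : Subset m) (x : Fin m) {L : List (Fin m)} → S CoveredBy (x ∷ L) → (S [ x ]≔ false) CoveredBy L
covered-tail S x cov k Sk with k ≟ x
... | yes refl = contradiction (trans (sym Sk) (lookup∘update x S false)) (λ ())
... | no k≢x with cov k (trans (sym (lookup∘update′ k≢x S false)) Sk)
...   | here k≡x  = contradiction k≡x k≢x
...   | there k∈L = k∈L

covered-[] : (S : Subset m) → S CoveredBy [] → ∣ S ∣ ≡ 0
covered-[] []          cov = refl
covered-[] (true ∷ S)  cov with cov zero refl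
... | ()
covered-[] (false ∷ S) cov = covered-[] S (λ k Sk → contradiction (cov (suc k) Sk) (λ ()))

∣S∣≡0⇒isEmpty : (S : Subset m) → ∣ S ∣ ≡ 0 → isEmpty S ≡ true
∣S∣≡0⇒isEmpty []          _     = refl
∣S∣≡0⇒isEmpty (false ∷ S) ∣S∣≡0 = ∣S∣≡0⇒isEmpty S ∣S∣≡0

update-id : (S : Subset m) (x : Fin m) → lookup S x ≡ false → S [ x ]≔ false ≡ S
update-id S x Sx = trans (cong (S [ x ]≔_) (sym Sx)) ([]≔-lookup S x)

covered⇒≤ : (S : Subset m) (L : List (Fin m)) → S CoveredBy L → ∣ S ∣ ≤ length L
covered⇒≤ S []      cov = ℕ.≤-reflexive (covered-[] S cov)
covered⇒≤ S (x ∷ L) cov with lookup S x in Sx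
... | true  = ℕ.≤-trans (ℕ.≤-reflexive (∣-∣-delete S x Sx)) (s≤s (covered⇒≤ (S [ x ]≔ false) L (covered-tail S x cov)))
... | false = ℕ.≤-trans (covered⇒≤ S L (subst (_CoveredBy L) (update-id S x Sx) (covered-tail S x cov)))
                      (ℕ.n≤1+n _)

-- A pigeonhole count: an entry that is not among the values still to be met would leave too few
-- entries to cover `S`.
exhausts-covered : (S : Subset m) (L : List (Fin m)) → S CoveredBy L → ∣ S ∣ ≡ length L → exhausts S L ≡ true
exhausts-covered S []      cov eq = ∣S∣≡0⇒isEmpty S eq
exhausts-covered S (x ∷ L) cov eq with lookup S x in Sx
... | true  = exhausts-covered (S [ x ]≔ false) L (covered-tail S x cov) (ℕ.suc-injective (trans (sym (∣-∣-delete S x Sx)) eq))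
... | false = contradiction
  (ℕ.≤-trans (ℕ.≤-reflexive (sym eq)) (covered⇒≤ S L (subst (_CoveredBy L) (update-id S x Sx) (covered-tail S x cov))))
  ℕ.1+n≰n

-- Path sums that vanish, and path sums with a single contributing path.

corner-false : ∀ c (R : List A) → corner c R false ≡ false
corner-false zero    []      = refl
corner-false zero    (_ ∷ _) = refl
corner-false (suc c) R       = refl

-- A path collects entries of the matrix, so a property of all entries holds along every path. It is
-- applied with `P` saying that an entry differs from a fixed value.
∑-path-vanishes : (P : A → Set) {F : List A → Bool} → (∀ L → All P L → F L ≡ false) →
  ∀ c (R : List (Vec A c)) → All (λ r → ∀ j → P (lookup r j)) R → ∑-path c R F ≡ false
∑-path-vanishes P F≡0 zero    R       PR = refl
∑-path-vanishes P F≡0 (suc c) []      PR = refl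
∑-path-vanishes P {F} F≡0 (suc c) ((a ∷ r) ∷ R) (Pr ∷ PR) = cong₂ _xor_
  (trans (cong (corner c R) (F≡0 _ (Pr zero ∷ []))) (corner-false c R))
  (cong₂ _xor_
    (∑-path-vanishes P (λ L PL → F≡0 _ (Pr zero ∷ PL)) (suc c) R PR)
    (∑-path-vanishes P (λ L PL → F≡0 _ (Pr zero ∷ PL)) c (r ∷ map tail R)
      ((Pr ∘ suc) ∷ All.map⁺ (All.map (λ {r} Pr j → subst P (lookup-tail r j) (Pr (suc j))) PR))))
  where
  lookup-tail : (r : Vec _ (suc c)) (j : Fin c) → lookup r (suc j) ≡ lookup (tail r) j
  lookup-tail (x ∷ r) j = refl

∑-path-false : ∀ c (R : List (Vec A c)) → ∑-path c R (λ _ → false) ≡ false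
∑-path-false zero    R       = refl
∑-path-false (suc c) []      = refl
∑-path-false (suc c) (r ∷ R) = cong₂ _xor_ (corner-false c R)
  (cong₂ _xor_ (∑-path-false (suc c) R) (∑-path-false c (map tail (r ∷ R))))

∑-path-∧ : ∀ c (R : List (Vec A c)) b F → ∑-path c R (λ L → b ∧ F L) ≡ b ∧ ∑-path c R F
∑-path-∧ c R true  F = refl
∑-path-∧ c R false F = ∑-path-false c R

-- Paths that visit two columns of a constant row repeat an entry.
∑-path-repeat : ∀ c (S : Subset m) a (R : List (Vec (Fin m) c)) → lookup S a ≡ false →
  ∑-path c (replicate c a ∷ R) (exhausts S) ≡ false
∑-path-repeat zero    S a R Sa = refl
∑-path-repeat (suc c) S a R Sa = cong₂ _xor_ (trans (cong (corner c R) (Sa∧ _)) (corner-false c R))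
  (cong₂ _xor_ (starts (suc c) R) (starts c (map tail (replicate (suc c) a ∷ R))))
  where
  Sa∧ : ∀ b → lookup S a ∧ b ≡ false
  Sa∧ b = cong (_∧ b) Sa
  starts : ∀ c (R : List (Vec _ c)) → ∑-path c R (exhausts S ∘ (a ∷_)) ≡ false
  starts c R = trans (∑-path-cong c R (λ L → Sa∧ _)) (∑-path-false c R)

-- This sum arises from a step to the right in a constant row: `a` has just been used up, and the
-- path continues in the same row.
∑-path-repeat′ : ∀ c (S : Subset m) a R → ∑-path c (replicate c a ∷ R) (exhausts S ∘ (a ∷_)) ≡ false
∑-path-repeat′ c S a R = trans (∑-path-∧ c _ (lookup S a) (exhausts (S [ a ]≔ false)))
  (trans (cong (lookup S a ∧_) (∑-path-repeat c (S [ a ]≔ false) a R (lookup∘update a S false))) (∧-zeroʳ _))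

constants : ∀ c → List A → List (Vec A c)
constants c = map (replicate c)

∑-path-constants₁ : ∀ (a : A) L F → ∑-path 1 (constants 1 (a ∷ L)) F ≡ F (a ∷ L)
∑-path-constants₁ a []      F = xor-identityʳ _
∑-path-constants₁ a (b ∷ L) F = trans (xor-identityʳ _) (∑-path-constants₁ b L (F ∘ (a ∷_)))

-- With at least two columns every path steps to the right somewhere, and in a constant row this
-- repeats an entry.
∑-path-constants : ∀ c (S : Subset m) L → ∑-path (suc (suc c)) (constants _ L) (exhausts S) ≡ false
∑-path-constants c S []      = refl
∑-path-constants c S (a ∷ L) = cong₂ _xor_
  (trans (∑-path-∧ (suc (suc c)) (constants _ L) (lookup S a) (exhausts (S [ a ]≔ false)))
    (trans (cong (lookup S a ∧_) (∑-path-constants c (S [ a ]≔ false) L)) (∧-zeroʳ _)))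
  (∑-path-repeat′ (suc c) S a _)

tail-constants : ∀ c (L : List A) → map tail (constants (suc c) L) ≡ constants c L
tail-constants c []      = refl
tail-constants c (a ∷ L) = cong (_ ∷_) (tail-constants c L)

-- A path that leaves `f` before the last column must step to the right in a constant row later. The
-- only path left runs through all of `f` and then down the last column.
∑-path-∷constants : ∀ c (S : Subset m) (f : Vec (Fin m) (suc c)) L →
  ∑-path (suc c) (f ∷ constants (suc c) L) (exhausts S) ≡ exhausts S (toList f ++ L)
∑-path-∷constants zero    S (a ∷ []) []      = xor-identityʳ _
∑-path-∷constants zero    S (a ∷ []) (b ∷ L) =
  trans (xor-identityʳ _) (∑-path-constants₁ b L (exhausts S ∘ (a ∷_)))
∑-path-∷constants (suc c) S (a ∷ f) L = cong₂ _xor_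
  (trans (∑-path-∧ (suc (suc c)) (constants _ L) (lookup S a) (exhausts (S [ a ]≔ false)))
    (trans (cong (lookup S a ∧_) (∑-path-constants c (S [ a ]≔ false) L)) (∧-zeroʳ _)))
  (begin
    ∑-path (suc c) (f ∷ map tail (constants (suc (suc c)) L)) (exhausts S ∘ (a ∷_))
      ≡⟨ cong (λ R → ∑-path (suc c) (f ∷ R) (exhausts S ∘ (a ∷_))) (tail-constants (suc c) L) ⟩
    ∑-path (suc c) (f ∷ constants (suc c) L) (exhausts S ∘ (a ∷_))
      ≡⟨ ∑-path-∧ (suc c) (f ∷ constants (suc c) L) (lookup S a) (exhausts (S [ a ]≔ false)) ⟩
    lookup S a ∧ ∑-path (suc c) (f ∷ constants (suc c) L) (exhausts (S [ a ]≔ false))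
      ≡⟨ cong (lookup S a ∧_) (∑-path-∷constants c (S [ a ]≔ false) f L) ⟩
    lookup S a ∧ exhausts (S [ a ]≔ false) (toList f ++ L) ∎)
  where open ≡-Reasoning

-- The constant rows above `f` may be crossed only downwards as well, so the single contributing
-- path descends the first column, runs along `f` and descends the last column.
∑-path-constants-∷-constants : ∀ c (S : Subset m) L (f : Vec (Fin m) (suc c)) L′ →
  ∑-path (suc c) (constants (suc c) L ++ f ∷ constants (suc c) L′) (exhausts S) ≡ exhausts S (L ++ toList f ++ L′)
∑-path-constants-∷-constants c S []      f L′ = ∑-path-∷constants c S f L′
∑-path-constants-∷-constants c S (a ∷ L) f L′ = begin
  corner c R (exhausts S (a ∷ [])) xor
  (∑-path (suc c) R (exhausts S ∘ (a ∷_)) xor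
   ∑-path c (replicate c a ∷ map tail R) (exhausts S ∘ (a ∷_)))
    ≡⟨ cong₂ _xor_ (corner-nonempty c (constants (suc c) L) (exhausts S (a ∷ [])))
        (cong₂ _xor_ (∑-path-∧ (suc c) R (lookup S a) (exhausts (S [ a ]≔ false))) (∑-path-repeat′ c S a (map tail R))) ⟩
  (lookup S a ∧ ∑-path (suc c) R (exhausts (S [ a ]≔ false))) xor false
    ≡⟨ trans (xor-identityʳ _) (cong (lookup S a ∧_) (∑-path-constants-∷-constants c (S [ a ]≔ false) L f L′)) ⟩
  exhausts S (a ∷ L ++ toList f ++ L′) ∎
  where
  open ≡-Reasoning
  R = constants (suc c) L ++ f ∷ constants (suc c) L′
  corner-nonempty : ∀ c {A : Set} (X : List A) {y Y} b → corner c (X ++ y ∷ Y) b ≡ false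
  corner-nonempty zero    []      b = refl
  corner-nonempty zero    (_ ∷ _) b = refl
  corner-nonempty (suc c) X       b = refl

-- Sums mod 2 over all subsets.

xorList : List Bool → Bool
xorList = foldr _xor_ false

xorList-++ : ∀ xs ys → xorList (xs ++ ys) ≡ xorList xs xor xorList ys
xorList-++ []           ys = refl
xorList-++ (false ∷ xs) ys = xorList-++ xs ys
xorList-++ (true  ∷ xs) ys = trans (cong not (xorList-++ xs ys)) (not-distribˡ-xor (xorList xs) (xorList ys))

sumZ₂-suc : (g : Subset (suc N) → Bool) → sumZ₂ g ≡ sumZ₂ (g ∘ (true ∷_)) xor sumZ₂ (g ∘ (false ∷_))
sumZ₂-suc {N} g = begin
  xorList (map g (map (true ∷_) (allSubsets N) ++ map (false ∷_) (allSubsets N)))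
    ≡⟨ cong xorList (map-++ g (map (true ∷_) (allSubsets N)) _) ⟩
  xorList (map g (map (true ∷_) (allSubsets N)) ++ map g (map (false ∷_) (allSubsets N)))
    ≡⟨ xorList-++ (map g (map (true ∷_) (allSubsets N))) _ ⟩
  xorList (map g (map (true ∷_) (allSubsets N))) xor xorList (map g (map (false ∷_) (allSubsets N)))
    ≡⟨ cong₂ (λ xs ys → xorList xs xor xorList ys) (sym (map-∘ (allSubsets N))) (sym (map-∘ (allSubsets N))) ⟩
  sumZ₂ (g ∘ (true ∷_)) xor sumZ₂ (g ∘ (false ∷_)) ∎
  where open ≡-Reasoning

sumZ₂-cong : {g h : Subset N → Bool} → (∀ σ → g σ ≡ h σ) → sumZ₂ g ≡ sumZ₂ h
sumZ₂-cong {N} g≡h = cong xorList (map-cong g≡h (allSubsets N))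

sumZ₂-false : {g : Subset N → Bool} → (∀ σ → g σ ≡ false) → sumZ₂ g ≡ false
sumZ₂-false {zero}      g≡0 = trans (xor-identityʳ _) (g≡0 [])
sumZ₂-false {suc N} {g} g≡0 = trans (sumZ₂-suc g)
  (cong₂ _xor_ (sumZ₂-false (g≡0 ∘ (true ∷_))) (sumZ₂-false (g≡0 ∘ (false ∷_))))

sumZ₂-xor : (g h : Subset N → Bool) → sumZ₂ (λ σ → g σ xor h σ) ≡ sumZ₂ g xor sumZ₂ h
sumZ₂-xor {zero}  g h = xor-interchange (g []) (h []) false false
sumZ₂-xor {suc N} g h = begin
  sumZ₂ (λ σ → g σ xor h σ)
    ≡⟨ sumZ₂-suc (λ σ → g σ xor h σ) ⟩
  sumZ₂ (λ σ → g (true ∷ σ) xor h (true ∷ σ)) xor sumZ₂ (λ σ → g (false ∷ σ) xor h (false ∷ σ))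
    ≡⟨ cong₂ _xor_ (sumZ₂-xor (g ∘ (true ∷_)) (h ∘ (true ∷_))) (sumZ₂-xor (g ∘ (false ∷_)) (h ∘ (false ∷_))) ⟩
  (sumZ₂ (g ∘ (true ∷_)) xor sumZ₂ (h ∘ (true ∷_))) xor (sumZ₂ (g ∘ (false ∷_)) xor sumZ₂ (h ∘ (false ∷_)))
    ≡⟨ xor-interchange (sumZ₂ (g ∘ (true ∷_))) _ _ _ ⟩
  (sumZ₂ (g ∘ (true ∷_)) xor sumZ₂ (g ∘ (false ∷_))) xor (sumZ₂ (h ∘ (true ∷_)) xor sumZ₂ (h ∘ (false ∷_)))
    ≡⟨ sym (cong₂ _xor_ (sumZ₂-suc g) (sumZ₂-suc h)) ⟩
  sumZ₂ g xor sumZ₂ h ∎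
  where open ≡-Reasoning

sumZ₂-∧ : ∀ b (g : Subset N → Bool) → sumZ₂ (λ σ → b ∧ g σ) ≡ b ∧ sumZ₂ g
sumZ₂-∧ true  g = refl
sumZ₂-∧ {N} false g = sumZ₂-false {N} (λ _ → refl)

sumZ₂-comm : (h : Subset N → Subset M → Bool) →
  sumZ₂ (λ σ → sumZ₂ (h σ)) ≡ sumZ₂ (λ τ → sumZ₂ (λ σ → h σ τ))
sumZ₂-comm {zero}  h = trans (xor-identityʳ (sumZ₂ (h []))) (sumZ₂-cong (λ τ → sym (xor-identityʳ (h [] τ))))
sumZ₂-comm {suc N} h = begin
  sumZ₂ (λ σ → sumZ₂ (h σ))
    ≡⟨ sumZ₂-suc (λ σ → sumZ₂ (h σ)) ⟩
  sumZ₂ (λ σ → sumZ₂ (h (true ∷ σ))) xor sumZ₂ (λ σ → sumZ₂ (h (false ∷ σ)))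
    ≡⟨ cong₂ _xor_ (sumZ₂-comm (h ∘ (true ∷_))) (sumZ₂-comm (h ∘ (false ∷_))) ⟩
  sumZ₂ (λ τ → sumZ₂ (λ σ → h (true ∷ σ) τ)) xor sumZ₂ (λ τ → sumZ₂ (λ σ → h (false ∷ σ) τ))
    ≡⟨ sym (sumZ₂-xor (λ τ → sumZ₂ (λ σ → h (true ∷ σ) τ)) _) ⟩
  sumZ₂ (λ τ → sumZ₂ (λ σ → h (true ∷ σ) τ) xor sumZ₂ (λ σ → h (false ∷ σ) τ))
    ≡⟨ sumZ₂-cong (λ τ → sym (sumZ₂-suc (λ σ → h σ τ))) ⟩
  sumZ₂ (λ τ → sumZ₂ (λ σ → h σ τ)) ∎
  where open ≡-Reasoning

sumZ₂-single : (g : Subset N → Bool) (σ : Subset N) → (∀ ρ → ρ ≢ σ → g ρ ≡ false) → sumZ₂ g ≡ g σ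
sumZ₂-single g []          g≡0 = xor-identityʳ _
sumZ₂-single g (true ∷ σ)  g≡0 = trans (sumZ₂-suc g) (trans
  (cong₂ _xor_ (sumZ₂-single (g ∘ (true ∷_)) σ (λ ρ ρ≢σ → g≡0 _ (ρ≢σ ∘ cong tail)))
               (sumZ₂-false (λ ρ → g≡0 (false ∷ ρ) (λ ()))))
  (xor-identityʳ _))
sumZ₂-single g (false ∷ σ) g≡0 = trans (sumZ₂-suc g)
  (cong₂ _xor_ (sumZ₂-false (λ ρ → g≡0 (true ∷ ρ) (λ ())))
               (sumZ₂-single (g ∘ (false ∷_)) σ (λ ρ ρ≢σ → g≡0 _ (ρ≢σ ∘ cong tail))))

-- The coboundary `∑-facets` of a cochain, and its adjointness to the boundary.

∑-facets : (Subset N → Bool) → Subset N → Bool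
∑-facets g τ = sumZ₂ (λ σ → g σ ∧ isFacet σ τ)

-- A test for equality in the form to which `isFacet` reduces when the first vertex belongs to the
-- larger set alone.
same : Subset N → Subset N → Bool
same τ σ = ⌊ τ ⊆? σ ⌋ ∧ (∣ σ ∣ ≡ᵇ ∣ τ ∣)

-- Both decisions have the same `does` by computation, whereas `⌊_⌋` is stuck on a decision that is
-- not yet known; hence the detour through `does`.
⌊⊆?⌋-∷ : ∀ b (τ σ : Subset N) → ⌊ (b ∷ τ) ⊆? (true ∷ σ) ⌋ ≡ ⌊ τ ⊆? σ ⌋
⌊⊆?⌋-∷ true  τ σ = trans (isYes≗does ((true ∷ τ) ⊆? (true ∷ σ))) (sym (isYes≗does (τ ⊆? σ)))
⌊⊆?⌋-∷ false τ σ = trans (isYes≗does ((false ∷ τ) ⊆? (true ∷ σ))) (sym (isYes≗does (τ ⊆? σ)))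

⌊⊆?⌋-false : (τ σ : Subset N) → ⌊ (false ∷ τ) ⊆? (false ∷ σ) ⌋ ≡ ⌊ τ ⊆? σ ⌋
⌊⊆?⌋-false τ σ = trans (isYes≗does ((false ∷ τ) ⊆? (false ∷ σ))) (sym (isYes≗does (τ ⊆? σ)))

⊆∧<⇒false : (τ σ : Subset N) → ⌊ τ ⊆? σ ⌋ ∧ (suc ∣ σ ∣ ≡ᵇ ∣ τ ∣) ≡ false
⊆∧<⇒false τ σ with τ ⊆? σ
... | no _ = refl
... | yes τ⊆σ with suc ∣ σ ∣ ≡ᵇ ∣ τ ∣ in eq
...   | false = refl
...   | true  = contradiction
  (ℕ.≤-trans (ℕ.≤-reflexive (ℕ.≡ᵇ⇒≡ (suc ∣ σ ∣) ∣ τ ∣ (Equivalence.from T-≡ eq))) (p⊆q⇒∣p∣≤∣q∣ τ⊆σ)) ℕ.1+n≰n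

isFacet-true-true : (σ τ : Subset N) → isFacet (true ∷ σ) (true ∷ τ) ≡ isFacet σ τ
isFacet-true-true σ τ = cong (_∧ (∣ τ ∣ ≡ᵇ suc ∣ σ ∣)) (⌊⊆?⌋-∷ true σ τ)

isFacet-false-false : (σ τ : Subset N) → isFacet (false ∷ σ) (false ∷ τ) ≡ isFacet σ τ
isFacet-false-false σ τ = cong (_∧ (∣ τ ∣ ≡ᵇ suc ∣ σ ∣)) (⌊⊆?⌋-false σ τ)

isFacet-false-true : (σ τ : Subset N) → isFacet (false ∷ σ) (true ∷ τ) ≡ same σ τ
isFacet-false-true σ τ = cong (_∧ (∣ τ ∣ ≡ᵇ ∣ σ ∣)) (⌊⊆?⌋-∷ false σ τ)

same-true-true : (σ τ : Subset N) → same (true ∷ σ) (true ∷ τ) ≡ same σ τ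
same-true-true σ τ = cong (_∧ (∣ τ ∣ ≡ᵇ ∣ σ ∣)) (⌊⊆?⌋-∷ true σ τ)

same-false-false : (σ τ : Subset N) → same (false ∷ σ) (false ∷ τ) ≡ same σ τ
same-false-false σ τ = cong (_∧ (∣ τ ∣ ≡ᵇ ∣ σ ∣)) (⌊⊆?⌋-false σ τ)

same-false-true : (σ τ : Subset N) → same (false ∷ σ) (true ∷ τ) ≡ false
same-false-true σ τ = trans (cong (_∧ (suc ∣ τ ∣ ≡ᵇ ∣ σ ∣)) (⌊⊆?⌋-∷ false σ τ)) (⊆∧<⇒false σ τ)

same⇒≡ : (σ τ : Subset N) → same σ τ ≡ true → σ ≡ τ
same⇒≡ []          []          _ = refl
same⇒≡ (true  ∷ σ) (true  ∷ τ) s = cong (true ∷_) (same⇒≡ σ τ (trans (sym (same-true-true σ τ)) s))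
same⇒≡ (false ∷ σ) (false ∷ τ) s = cong (false ∷_) (same⇒≡ σ τ (trans (sym (same-false-false σ τ)) s))
same⇒≡ (false ∷ σ) (true  ∷ τ) s = contradiction (trans (sym s) (same-false-true σ τ)) (λ ())

same-refl : (σ : Subset N) → same σ σ ≡ true
same-refl []          = refl
same-refl (true  ∷ σ) = trans (same-true-true σ σ) (same-refl σ)
same-refl (false ∷ σ) = trans (same-false-false σ σ) (same-refl σ)

same-≢ : {σ τ : Subset N} → σ ≢ τ → same σ τ ≡ false
same-≢ {σ = σ} {τ} σ≢τ with same σ τ in eq
... | false = refl
... | true  = contradiction (same⇒≡ σ τ eq) σ≢τ

-- A facet either drops the first vertex, which leaves `false ∷ τ`, or keeps it and drops a vertex
-- of `τ`.
∑-facets-true : (g : Subset (suc N) → Bool) (τ : Subset N) →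
  ∑-facets g (true ∷ τ) ≡ g (false ∷ τ) xor ∑-facets (g ∘ (true ∷_)) τ
∑-facets-true g τ = begin
  ∑-facets g (true ∷ τ)
    ≡⟨ sumZ₂-suc (λ σ → g σ ∧ isFacet σ (true ∷ τ)) ⟩
  sumZ₂ (λ σ → g (true ∷ σ) ∧ isFacet (true ∷ σ) (true ∷ τ)) xor
  sumZ₂ (λ σ → g (false ∷ σ) ∧ isFacet (false ∷ σ) (true ∷ τ))
    ≡⟨ cong₂ _xor_ (sumZ₂-cong (λ σ → cong (g (true ∷ σ) ∧_) (isFacet-true-true σ τ)))
        (trans (sumZ₂-cong (λ σ → cong (g (false ∷ σ) ∧_) (isFacet-false-true σ τ)))
        (trans (sumZ₂-single _ τ (λ σ σ≢τ → trans (cong (g (false ∷ σ) ∧_) (same-≢ σ≢τ)) (∧-zeroʳ _)))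
               (trans (cong (g (false ∷ τ) ∧_) (same-refl τ)) (∧-identityʳ _)))) ⟩
  ∑-facets (g ∘ (true ∷_)) τ xor g (false ∷ τ)
    ≡⟨ xor-comm _ (g (false ∷ τ)) ⟩
  g (false ∷ τ) xor ∑-facets (g ∘ (true ∷_)) τ ∎
  where open ≡-Reasoning

∑-facets-false : (g : Subset (suc N) → Bool) (τ : Subset N) →
  ∑-facets g (false ∷ τ) ≡ ∑-facets (g ∘ (false ∷_)) τ
∑-facets-false g τ = begin
  ∑-facets g (false ∷ τ)
    ≡⟨ sumZ₂-suc (λ σ → g σ ∧ isFacet σ (false ∷ τ)) ⟩
  sumZ₂ (λ σ → g (true ∷ σ) ∧ false) xor sumZ₂ (λ σ → g (false ∷ σ) ∧ isFacet (false ∷ σ) (false ∷ τ))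
    ≡⟨ cong₂ _xor_ (sumZ₂-false (λ σ → ∧-zeroʳ (g (true ∷ σ))))
        (sumZ₂-cong (λ σ → cong (g (false ∷ σ) ∧_) (isFacet-false-false σ τ))) ⟩
  ∑-facets (g ∘ (false ∷_)) τ ∎
  where open ≡-Reasoning

∑-facets-cong : {g h : Subset N → Bool} → (∀ σ → g σ ≡ h σ) → ∀ τ → ∑-facets g τ ≡ ∑-facets h τ
∑-facets-cong g≡h τ = sumZ₂-cong (λ σ → cong (_∧ isFacet σ τ) (g≡h σ))

-- The identity that a boundary has no boundary: a face of codimension two lies in exactly two
-- facets.
∑-facets-isFacet : (ρ τ : Subset N) → ∑-facets (isFacet ρ) τ ≡ false
∑-facets-isFacet []          []          = refl
∑-facets-isFacet (true  ∷ ρ) (true  ∷ τ) = trans (∑-facets-true (isFacet (true ∷ ρ)) τ)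
  (trans (∑-facets-cong (isFacet-true-true ρ) τ) (∑-facets-isFacet ρ τ))
∑-facets-isFacet {suc N} (true ∷ ρ) (false ∷ τ) = trans (∑-facets-false (isFacet (true ∷ ρ)) τ) (sumZ₂-false {N} (λ _ → refl))
∑-facets-isFacet (false ∷ ρ) (false ∷ τ) = trans (∑-facets-false (isFacet (false ∷ ρ)) τ)
  (trans (∑-facets-cong (isFacet-false-false ρ) τ) (∑-facets-isFacet ρ τ))
∑-facets-isFacet (false ∷ ρ) (true  ∷ τ) = begin
  ∑-facets (isFacet (false ∷ ρ)) (true ∷ τ)
    ≡⟨ ∑-facets-true (isFacet (false ∷ ρ)) τ ⟩
  isFacet (false ∷ ρ) (false ∷ τ) xor ∑-facets (λ σ → isFacet (false ∷ ρ) (true ∷ σ)) τ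
    ≡⟨ cong₂ _xor_ (isFacet-false-false ρ τ) (trans (∑-facets-cong (isFacet-false-true ρ) τ)
        (sumZ₂-single _ ρ (λ σ σ≢ρ → cong (_∧ isFacet σ τ) (same-≢ (σ≢ρ ∘ sym))))) ⟩
  isFacet ρ τ xor (same ρ ρ ∧ isFacet ρ τ)
    ≡⟨ cong (λ b → isFacet ρ τ xor (b ∧ isFacet ρ τ)) (same-refl ρ) ⟩
  isFacet ρ τ xor isFacet ρ τ
    ≡⟨ xor-same (isFacet ρ τ) ⟩
  false ∎
  where open ≡-Reasoning

isFacet⇒delete : (σ τ : Subset N) → isFacet σ τ ≡ true → ∃ λ t → lookup τ t ≡ true × σ ≡ τ [ t ]≔ false
isFacet⇒delete []          []          ()
isFacet⇒delete (true  ∷ σ) (true  ∷ τ) facet =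
  let t , τt , σ≡ = isFacet⇒delete σ τ (trans (sym (isFacet-true-true σ τ)) facet) in suc t , τt , cong (true ∷_) σ≡
isFacet⇒delete (false ∷ σ) (false ∷ τ) facet =
  let t , τt , σ≡ = isFacet⇒delete σ τ (trans (sym (isFacet-false-false σ τ)) facet) in suc t , τt , cong (false ∷_) σ≡
isFacet⇒delete (false ∷ σ) (true  ∷ τ) facet =
  zero , refl , cong (false ∷_) (same⇒≡ σ τ (trans (sym (isFacet-false-true σ τ)) facet))

delete-isFacet : (τ : Subset N) (t : Fin N) → lookup τ t ≡ true → isFacet (τ [ t ]≔ false) τ ≡ true
delete-isFacet (true  ∷ τ) zero    _  = trans (isFacet-false-true τ τ) (same-refl τ)
delete-isFacet (true  ∷ τ) (suc t) τt = trans (isFacet-true-true (τ [ t ]≔ false) τ) (delete-isFacet τ t τt)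
delete-isFacet (false ∷ τ) (suc t) τt = trans (isFacet-false-false (τ [ t ]≔ false) τ) (delete-isFacet τ t τt)

-- Boundary and coboundary are adjoint: both sides sum over the pairs of a simplex and one of its
-- facets.
∑-facets-boundary : (φ d : Subset N → Bool) →
  sumZ₂ (λ σ → φ σ ∧ boundary d σ) ≡ sumZ₂ (λ τ → d τ ∧ ∑-facets φ τ)
∑-facets-boundary φ d = begin
  sumZ₂ (λ σ → φ σ ∧ sumZ₂ (λ τ → d τ ∧ isFacet σ τ))
    ≡⟨ sumZ₂-cong (λ σ → sym (sumZ₂-∧ (φ σ) (λ τ → d τ ∧ isFacet σ τ))) ⟩
  sumZ₂ (λ σ → sumZ₂ (λ τ → φ σ ∧ (d τ ∧ isFacet σ τ)))
    ≡⟨ sumZ₂-comm (λ σ τ → φ σ ∧ (d τ ∧ isFacet σ τ)) ⟩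
  sumZ₂ (λ τ → sumZ₂ (λ σ → φ σ ∧ (d τ ∧ isFacet σ τ)))
    ≡⟨ sumZ₂-cong (λ τ → trans (sumZ₂-cong (λ σ → ∧-swap (φ σ) (d τ) (isFacet σ τ))) (sumZ₂-∧ (d τ) (λ σ → φ σ ∧ isFacet σ τ))) ⟩
  sumZ₂ (λ τ → d τ ∧ ∑-facets φ τ) ∎
  where
  open ≡-Reasoning
  ∧-swap : ∀ a b c → a ∧ (b ∧ c) ≡ b ∧ (a ∧ c)
  ∧-swap true  b c = refl
  ∧-swap false b c = sym (∧-zeroʳ b)

-- Simplices as lists of rows.

rows : (Fin N → A) → Subset N → List A
rows e []          = []
rows e (true ∷ σ)  = e zero ∷ rows (e ∘ suc) σ
rows e (false ∷ σ) = rows (e ∘ suc) σ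

-- Rows follow the order of the indices, so passing to a facet deletes one row and keeps the order
-- of the others.
∑-facets-rows : (e : Fin N → A) (F : List A → Bool) (τ : Subset N) →
  ∑-facets (F ∘ rows e) τ ≡ ∑-delete F (rows e τ)
∑-facets-rows e F []          = trans (xor-identityʳ (F [] ∧ false)) (∧-zeroʳ (F []))
∑-facets-rows e F (true  ∷ τ) = trans (∑-facets-true (F ∘ rows e) τ)
  (cong (F (rows (e ∘ suc) τ) xor_) (∑-facets-rows (e ∘ suc) (F ∘ (e zero ∷_)) τ))
∑-facets-rows e F (false ∷ τ) = trans (∑-facets-false (F ∘ rows e) τ) (∑-facets-rows (e ∘ suc) F τ)

length-rows : (e : Fin N → A) (σ : Subset N) → length (rows e σ) ≡ ∣ σ ∣
length-rows e []          = refl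
length-rows e (true  ∷ σ) = cong suc (length-rows (e ∘ suc) σ)
length-rows e (false ∷ σ) = length-rows (e ∘ suc) σ

All-rows : {P : A → Set} (e : Fin N → A) (σ : Subset N) → (∀ i → lookup σ i ≡ true → P (e i)) → All P (rows e σ)
All-rows e []          Pe = []
All-rows e (true  ∷ σ) Pe = Pe zero refl ∷ All-rows (e ∘ suc) σ (Pe ∘ suc)
All-rows e (false ∷ σ) Pe = All-rows (e ∘ suc) σ (Pe ∘ suc)

∈-rows : (e : Fin N → A) (σ : Subset N) {i : Fin N} → lookup σ i ≡ true → e i ∈ rows e σ
∈-rows e (true  ∷ σ) {zero}  σi = here refl
∈-rows e (true  ∷ σ) {suc i} σi = there (∈-rows (e ∘ suc) σ σi)
∈-rows e (false ∷ σ) {suc i} σi = ∈-rows (e ∘ suc) σ σi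

-- The enumeration is arbitrary, so the position of the distinguished row is unknown; the rows
-- before and after it are kept as two lists. It serves to isolate the injective map among constant
-- ones.
rows-split : {P : A → Set} (e : Fin N → A) (σ : Subset N) (i : Fin N) → lookup σ i ≡ true →
  (∀ k → lookup σ k ≡ true → k ≢ i → P (e k)) →
  ∃ λ X → ∃ λ Y → rows e σ ≡ X ++ e i ∷ Y × All P X × All P Y
rows-split e (true ∷ σ) zero σi Pe =
  [] , _ , refl , [] , All-rows (e ∘ suc) σ (λ k σk → Pe (suc k) σk (λ ()))
rows-split e (false ∷ σ) (suc i) σi Pe =
  rows-split (e ∘ suc) σ i σi (λ k σk k≢i → Pe (suc k) σk (k≢i ∘ suc-injective))
rows-split e (true ∷ σ) (suc i) σi Pe =
  let X , Y , eq , PX , PY = rows-split (e ∘ suc) σ i σi (λ k σk k≢i → Pe (suc k) σk (k≢i ∘ suc-injective))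
  in e zero ∷ X , Y , cong (e zero ∷_) eq , Pe zero refl (λ ()) ∷ PX , PY

All-constants : ∀ c (X : List (Vec A c)) → All (λ r → ∃ λ a → r ≡ replicate c a) X → ∃ λ L → X ≡ constants c L
All-constants c []      []                   = [] , refl
All-constants c (_ ∷ X) ((a , refl) ∷ const) =
  let L , eq = All-constants c X const in a ∷ L , cong (_ ∷_) eq

lookup-removeAt : (r : Vec A (suc n)) (j : Fin (suc n)) (i : Fin n) → lookup (removeAt r j) i ≡ lookup r (punchIn j i)
lookup-removeAt (x ∷ r)     zero    i       = refl
lookup-removeAt (x ∷ y ∷ r) (suc j) zero    = refl
lookup-removeAt (x ∷ y ∷ r) (suc j) (suc i) = lookup-removeAt (y ∷ r) j i

-- Images of maps as subsets.

image : (Fin n → Fin N) → Subset N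
image {zero}  h = ⊥
image {suc n} h = image (h ∘ suc) [ h zero ]≔ true

∈-image : (h : Fin n → Fin N) (x : Fin n) → lookup (image h) (h x) ≡ true
∈-image h zero    = lookup∘update (h zero) (image (h ∘ suc)) true
∈-image h (suc x) with h (suc x) ≟ h zero
... | yes eq = trans (cong (lookup (image h)) eq) (∈-image h zero)
... | no neq = trans (lookup∘update′ neq (image (h ∘ suc)) true) (∈-image (h ∘ suc) x)

image-∈ : (h : Fin n → Fin N) (i : Fin N) → lookup (image h) i ≡ true → ∃ λ x → h x ≡ i
image-∈ {zero}  h i eq = contradiction (trans (sym eq) (lookup-replicate i false)) (λ ())
image-∈ {suc n} h i eq with i ≟ h zero
... | yes i≡ = zero , sym i≡
... | no i≢  =
  let x , hx≡i = image-∈ (h ∘ suc) i (trans (sym (lookup∘update′ i≢ (image (h ∘ suc)) true)) eq) in suc x , hx≡i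

∣image∣ : (h : Fin n → Fin N) → (∀ x y → h x ≡ h y → x ≡ y) → ∣ image h ∣ ≡ n
∣image∣ {zero} {N} h inj = ∣⊥∣≡0 N
∣image∣ {suc n} h inj = trans (∣-∣-update (image (h ∘ suc)) (h zero) fresh)
  (cong suc (∣image∣ (h ∘ suc) (λ x y eq → suc-injective (inj _ _ eq))))
  where
  fresh : lookup (image (h ∘ suc)) (h zero) ≡ false
  fresh with lookup (image (h ∘ suc)) (h zero) in eq
  ... | false = refl
  ... | true with image-∈ (h ∘ suc) (h zero) eq
  ...   | x , hx≡ with inj _ _ hx≡
  ...     | ()

-- The cocycle.

-- A path through `r` rows and `c` columns, both positive in number, has `r + c - 1` entries. A
-- nonzero value therefore requires `m - c + 1` rows, which is the number of vertices of a simplex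
-- of dimension `m - c`.
weight : ∀ c → (Fin N → Vec (Fin m) c) → Subset N → Bool
weight c e σ = ∑-path c (rows e σ) (exhausts ⊤)

weight-missing : ∀ c (e : Fin N → Vec (Fin m) c) (σ : Subset N) (k : Fin m) →
  (∀ i → lookup σ i ≡ true → ∀ j → k ≢ lookup (e i) j) → weight c e σ ≡ false
weight-missing c e σ k missing = ∑-path-vanishes (k ≢_) (exhausts-missing ⊤ (lookup-replicate k true))
  c (rows e σ) (All-rows e σ missing)

-- The value g j of a common neighbour g can only occur in column j, so the paths of the
-- matrix without column j miss it.
weight-cocycle : ∀ c (e : Fin N → Vec (Fin m) (suc (suc c))) (τ : Subset N) (g : Vec (Fin m) (suc (suc c))) →
  (∀ i → lookup τ i ≡ true → AdjG (e i) g) → ∑-facets (weight (suc (suc c)) e) τ ≡ false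
weight-cocycle {m = m} c e τ g adj = begin
  ∑-facets (weight (suc (suc c)) e) τ
    ≡⟨ ∑-facets-rows e (λ X → ∑-path (suc (suc c)) X (exhausts ⊤)) τ ⟩
  ∑-delete (λ X → ∑-path (suc (suc c)) X (exhausts ⊤)) R
    ≡⟨ sym (trans (cong (∑-delete (λ X → ∑-path (suc (suc c)) X (exhausts ⊤)) R xor_)
         (cong₂ _xor_ (sum-false {suc (suc c)} _ column) (single-suc c R (exhausts {m} ⊤ [])))) (xor-identityʳ _)) ⟩
  ∑-delete (λ X → ∑-path (suc (suc c)) X (exhausts ⊤)) R xor
    (∑-column (suc c) R (exhausts ⊤) xor single (suc c) R (exhausts {m} ⊤ []))
    ≡⟨ sym (∑-path-delete (suc c) R (exhausts ⊤)) ⟩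
  ∑-path (suc (suc c)) R (∑-delete (exhausts ⊤))
    ≡⟨ ∑-path-cong (suc (suc c)) R ∑-delete-exhausts-⊤ ⟩
  ∑-path (suc (suc c)) R (λ _ → false)
    ≡⟨ ∑-path-false (suc (suc c)) R ⟩
  false ∎
  where
  open ≡-Reasoning
  R = rows e τ
  column : ∀ j → ∑-path (suc c) (removeColumn j R) (exhausts ⊤) ≡ false
  column j = ∑-path-vanishes (lookup g j ≢_) (exhausts-missing ⊤ (lookup-replicate (lookup g j) true))
    (suc c) (removeColumn j R) (All.map⁺ (All-rows e τ (λ i τi k eq →
      adj i τi (punchIn j k) j (punchInᵢ≢i j k) (sym (trans eq (lookup-removeAt (e i) j k))))))

-- The cycle and its pairing with the cocycle.

module Sphere (c p N : ℕ) (e : Fin N → Vec (Fin (suc c + suc p)) (suc (suc c))) (enum : IsVertexEnumeration N e) where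

  m₀ n₀ : ℕ
  m₀ = suc c + suc p
  n₀ = suc (suc c)

  K : Subset N → Set
  K = IsNbhdSimplex (λ a b → AdjG (e a) (e b))

  -- Here `n = c + 2` and `m = n + p`, written as `(n - 1) + (p + 1)`. The `n - 1` small values are
  -- common to all the injective maps used below; the `p + 1` large values form the set `B`.
  small : Fin (suc c) → Fin m₀
  small j = j ↑ˡ suc p

  large : Fin (suc p) → Fin m₀
  large b = suc c ↑ʳ b

  small≢large : ∀ j b → small j ≢ large b
  small≢large j b eq with trans (sym (splitAt-↑ˡ (suc c) j (suc p)))
                            (trans (cong (splitAt (suc c)) eq) (splitAt-↑ʳ (suc c) (suc p) b))
  ... | ()

  -- The map `f` is `inj zero`; all the maps `inj b` serve as common neighbours of faces.
  inj : Fin (suc p) → Vec (Fin m₀) n₀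
  inj b = large b ∷ tabulate small

  inj-suc : ∀ b j → lookup (inj b) (suc j) ≡ small j
  inj-suc b j = lookup∘tabulate small j

  inj-injective : ∀ b → IsInjective (inj b)
  inj-injective b zero    zero    eq = refl
  inj-injective b zero    (suc j) eq = contradiction (sym (trans eq (inj-suc b j))) (small≢large j b)
  inj-injective b (suc i) zero    eq = contradiction (trans (sym (inj-suc b i)) eq) (small≢large i b)
  inj-injective b (suc i) (suc j) eq =
    cong suc (↑ˡ-injective (suc p) i j (trans (sym (inj-suc b i)) (trans eq (inj-suc b j))))

  -- The two maps agree away from the first column, and a large value never equals a small one.
  inj-adjacent : ∀ b b′ → AdjG (inj b) (inj b′)
  inj-adjacent b b′ zero    zero    i≢j eq = i≢j refl
  inj-adjacent b b′ zero    (suc j) i≢j eq = small≢large j b (sym (trans eq (inj-suc b′ j)))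
  inj-adjacent b b′ (suc i) zero    i≢j eq = small≢large i b′ (trans (sym (inj-suc b i)) eq)
  inj-adjacent b b′ (suc i) (suc j) i≢j eq =
    i≢j (cong suc (↑ˡ-injective (suc p) i j (trans (sym (inj-suc b i)) (trans eq (inj-suc b′ j)))))

  const : Fin m₀ → Vec (Fin m₀) n₀
  const = replicate n₀

  const-adjacent : ∀ a g → (∀ j → a ≢ lookup g j) → AdjG (const a) g
  const-adjacent a g a∉g i j _ eq = a∉g j (trans (sym (lookup-replicate i a)) eq)

  corners : Fin (suc (suc p)) → Vec (Fin m₀) n₀
  corners zero    = inj zero
  corners (suc b) = const (large b)

  index-of : ∀ f → IsVertexG f → ∃ λ a → e a ≡ f
  index-of = proj₂ (proj₂ enum)

  const-vertex : ∀ a → IsVertexG (const a)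
  const-vertex a = inj₁ (λ i j → trans (lookup-replicate i a) (sym (lookup-replicate j a)))

  corners-vertex : ∀ x → IsVertexG (corners x)
  corners-vertex zero    = inj₂ (inj-injective zero)
  corners-vertex (suc b) = const-vertex (large b)

  index : Fin (suc (suc p)) → Fin N
  index x = proj₁ (index-of (corners x) (corners-vertex x))

  e-index : ∀ x → e (index x) ≡ corners x
  e-index x = proj₂ (index-of (corners x) (corners-vertex x))

  inj≢const : ∀ b a → inj b ≢ const a
  inj≢const b a eq = small≢large zero b (trans (cong (head ∘ tail) eq) (sym (cong head eq)))

  corners-injective : ∀ x y → corners x ≡ corners y → x ≡ y
  corners-injective zero    zero    eq = refl
  corners-injective zero    (suc b) eq = contradiction eq (inj≢const zero (large b))
  corners-injective (suc b) zero    eq = contradiction (sym eq) (inj≢const zero (large b))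
  corners-injective (suc b) (suc d) eq = cong suc (↑ʳ-injective (suc c) b d (cong head eq))

  index-injective : ∀ x y → index x ≡ index y → x ≡ y
  index-injective x y eq = corners-injective x y (trans (sym (e-index x)) (trans (cong e eq) (e-index y)))

  simplex : Subset N
  simplex = image index

  face : Fin (suc (suc p)) → Subset N
  face x = simplex [ index x ]≔ false

  face-∋ : ∀ x y → y ≢ x → lookup (face x) (index y) ≡ true
  face-∋ x y y≢x = trans (lookup∘update′ (y≢x ∘ index-injective y x) simplex false) (∈-image index y)

  face-∈ : ∀ x i → lookup (face x) i ≡ true → ∃ λ y → y ≢ x × index y ≡ i
  face-∈ x i xi with i ≟ index x
  ... | yes refl = contradiction (trans (sym xi) (lookup∘update (index x) simplex false)) (λ ())
  ... | no i≢ with image-∈ index i (trans (sym (lookup∘update′ i≢ simplex false)) xi)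
  ...   | y , refl = y , (λ y≡x → i≢ (cong index y≡x)) , refl

  face-All : ∀ x (P : Vec (Fin m₀) n₀ → Set) → (∀ y → y ≢ x → P (corners y)) → ∀ i → lookup (face x) i ≡ true → P (e i)
  face-All x P Pc i xi with face-∈ x i xi
  ... | y , y≢x , refl = subst P (sym (e-index y)) (Pc y y≢x)

  ∣face∣ : ∀ x → ∣ face x ∣ ≡ suc p
  ∣face∣ x = ℕ.suc-injective (trans (sym (∣-∣-delete simplex (index x) (∈-image index x))) (∣image∣ index index-injective))

  -- The face without `f` consists of constants with large values, which a constant small value
  -- avoids. The face without the constant `large b` has the neighbour `inj b`, because the only
  -- large value of `inj b` is the omitted one.
  neighbour : Fin (suc (suc p)) → Vec (Fin m₀) n₀
  neighbour zero    = const (small zero)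
  neighbour (suc b) = inj b

  neighbour-vertex : ∀ x → IsVertexG (neighbour x)
  neighbour-vertex zero    = const-vertex (small zero)
  neighbour-vertex (suc b) = inj₂ (inj-injective b)

  neighbour-adjacent : ∀ x y → y ≢ x → AdjG (corners y) (neighbour x)
  neighbour-adjacent zero    zero    y≢x = contradiction refl y≢x
  neighbour-adjacent zero    (suc b) y≢x = const-adjacent (large b) (const (small zero))
    (λ j eq → small≢large zero b (sym (trans eq (lookup-replicate j _))))
  neighbour-adjacent (suc b) zero    y≢x = inj-adjacent zero b
  neighbour-adjacent (suc b) (suc d) y≢x = const-adjacent (large d) (inj b) λ where
    zero    eq → y≢x (cong suc (↑ʳ-injective (suc c) d b eq))
    (suc j) eq → small≢large j d (sym (trans eq (inj-suc b j)))

  other : ∀ x → ∃ λ (y : Fin (suc (suc p))) → y ≢ x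
  other zero    = suc zero , λ ()
  other (suc x) = zero , λ ()

  face-simplex : ∀ x → K (face x)
  face-simplex x = (index (proj₁ (other x)) , lookup⇒[]= _ (face x) (face-∋ x _ (proj₂ (other x)))) , proj₁ w ,
    λ v v∈ → face-All x (λ f → AdjG f (e (proj₁ w)))
      (λ y y≢x → subst (AdjG (corners y)) (sym (proj₂ w)) (neighbour-adjacent x y y≢x)) v ([]=⇒lookup v∈)
    where w = index-of (neighbour x) (neighbour-vertex x)

  -- The fundamental cycle mod 2 of the sphere that bounds `simplex`.
  z : Subset N → Bool
  z σ = isFacet σ simplex

  z-face : ∀ σ → z σ ≡ true → ∃ λ x → σ ≡ face x
  z-face σ zσ with isFacet⇒delete σ simplex zσ
  ... | t , t∈ , refl with image-∈ index t t∈
  ...   | x , refl = x , refl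

  z-chain : IsChain K p z
  z-chain σ zσ with z-face σ (Equivalence.to T-≡ zσ)
  ... | x , refl = face-simplex x , ∣face∣ x

  z-cycle : IsCycle z
  z-cycle τ _ = trans (sumZ₂-cong (λ σ → ∧-comm (z σ) (isFacet τ σ))) (∑-facets-isFacet τ simplex)

  φ : Subset N → Bool
  φ = weight n₀ e

  -- Without `f` no row contains a small value. Without the constant `large b`, for `b` other than
  -- `zero`, no row contains `large b`, since `f` takes no large value except `large zero`.
  φ-face-missing : ∀ x → x ≢ suc zero → φ (face x) ≡ false
  φ-face-missing x x≢1 = weight-missing n₀ e (face x) (missing x x≢1)
    (face-All x (λ f → ∀ j → missing x x≢1 ≢ lookup f j) (absent x x≢1))
    where
    missing : ∀ x → x ≢ suc zero → Fin m₀
    missing zero    _ = small zero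
    missing (suc b) _ = large b
    absent : ∀ x x≢1 y → y ≢ x → ∀ j → missing x x≢1 ≢ lookup (corners y) j
    absent zero          x≢1 zero    y≢x j       eq = y≢x refl
    absent zero          x≢1 (suc d) y≢x j       eq = small≢large zero d (trans eq (lookup-replicate j _))
    absent (suc b)       x≢1 zero    y≢x zero    eq = x≢1 (cong suc (↑ʳ-injective (suc c) b zero eq))
    absent (suc b)       x≢1 zero    y≢x (suc j) eq = small≢large j b (sym (trans eq (inj-suc zero j)))
    absent (suc b)       x≢1 (suc d) y≢x j       eq =
      y≢x (cong suc (sym (↑ʳ-injective (suc c) b d (trans eq (lookup-replicate j _)))))

  -- The rows are `f` and the constants outside its image. The single contributing path therefore
  -- meets every value, and it has exactly `m` entries.
  φ-face-one : φ (face (suc zero)) ≡ true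
  φ-face-one with rows-split {P = λ r → ∃ λ a → r ≡ const a} e (face (suc zero)) (index zero) (face-∋ (suc zero) zero (λ ()))
    (λ k k∈ k≢ → const-row k k∈ k≢)
    where
    const-row : ∀ k → lookup (face (suc zero)) k ≡ true → k ≢ index zero → ∃ λ a → e k ≡ const a
    const-row k k∈ k≢ with face-∈ (suc zero) k k∈
    ... | zero  , _ , refl = contradiction refl k≢
    ... | suc b , _ , refl = large b , e-index (suc b)
  ... | X , Y , rows≡ , X-const , Y-const with All-constants n₀ X X-const | All-constants n₀ Y Y-const
  ... | L , refl | L′ , refl = begin
    ∑-path n₀ (rows e (face (suc zero))) (exhausts ⊤)
      ≡⟨ cong (λ R → ∑-path n₀ R (exhausts ⊤)) rows-split′ ⟩
    ∑-path n₀ (constants n₀ L ++ inj zero ∷ constants n₀ L′) (exhausts ⊤)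
      ≡⟨ ∑-path-constants-∷-constants (suc c) ⊤ L (inj zero) L′ ⟩
    exhausts ⊤ (L ++ toList (inj zero) ++ L′)
      ≡⟨ exhausts-covered ⊤ (L ++ toList (inj zero) ++ L′) (λ k _ → covered k) (trans (∣⊤∣≡n m₀) (sym length≡m₀)) ⟩
    true ∎
    where
    open ≡-Reasoning
    rows-split′ : rows e (face (suc zero)) ≡ constants n₀ L ++ inj zero ∷ constants n₀ L′
    rows-split′ = trans rows≡ (cong (λ r → constants n₀ L ++ r ∷ constants n₀ L′) (e-index zero))
    head-∈ : ∀ {r} → r ∈ constants n₀ L ++ inj zero ∷ constants n₀ L′ → head r ∈ L ++ toList (inj zero) ++ L′
    head-∈ r∈ with ∈-++⁻ (constants n₀ L) r∈
    ... | inj₂ (here refl) = ∈-++⁺ʳ L (here refl)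
    ... | inj₁ r∈L with ∈-map⁻ const r∈L
    ...   | a , a∈L , refl = ∈-++⁺ˡ a∈L
    head-∈ r∈ | inj₂ (there r∈L′) with ∈-map⁻ const r∈L′
    ...   | a , a∈L′ , refl = ∈-++⁺ʳ L (∈-++⁺ʳ (toList (inj zero)) a∈L′)
    covered : ∀ k → k ∈ L ++ toList (inj zero) ++ L′
    covered k with splitAt (suc c) k in eq
    ... | inj₁ j = ∈-++⁺ʳ L (∈-++⁺ˡ (subst (_∈ toList (inj zero)) (trans (inj-suc zero j) (splitAt⁻¹-↑ˡ eq))
                     (∈-toList⁺ (∈-lookup (suc j) (inj zero)))))
    ... | inj₂ zero = ∈-++⁺ʳ L (here (sym (splitAt⁻¹-↑ʳ eq)))
    -- The large values outside the image of `f` come from the constant rows, through their first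
    -- entries.
    ... | inj₂ (suc b) = subst (_∈ _) (trans (cong head (e-index (suc (suc b)))) (splitAt⁻¹-↑ʳ eq))
          (head-∈ (subst (e (index (suc (suc b))) ∈_) rows-split′
            (∈-rows e (face (suc zero)) (face-∋ (suc zero) (suc (suc b)) (λ ())))))
    ∣L∣+∣L′∣ : length L + suc (length L′) ≡ suc p
    ∣L∣+∣L′∣ = begin
      length L + suc (length L′)
        ≡⟨ sym (cong₂ (λ a b → a + suc b) (length-map const L) (length-map const L′)) ⟩
      length (constants n₀ L) + suc (length (constants n₀ L′))
        ≡⟨ sym (length-++ (constants n₀ L)) ⟩
      length (constants n₀ L ++ inj zero ∷ constants n₀ L′)
        ≡⟨ sym (cong length rows-split′) ⟩
      length (rows e (face (suc zero)))
        ≡⟨ trans (length-rows e (face (suc zero))) (∣face∣ (suc zero)) ⟩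
      suc p ∎
    length≡m₀ : length (L ++ toList (inj zero) ++ L′) ≡ m₀
    length≡m₀ = begin
      length (L ++ toList (inj zero) ++ L′)
        ≡⟨ trans (length-++ L) (cong (length L +_) (trans (length-++ (toList (inj zero))) (cong (_+ length L′) (length-toList (inj zero))))) ⟩
      length L + (suc (suc c) + length L′)
        -- One entry of `f` is moved to the count of the `p + 1` rows, which leaves `n - 1` entries
        -- of `f`.
        ≡⟨ cong (length L +_) (sym (ℕ.+-suc (suc c) (length L′))) ⟩
      length L + (suc c + suc (length L′))
        ≡⟨ sym (ℕ.+-assoc (length L) (suc c) _) ⟩
      (length L + suc c) + suc (length L′)
        ≡⟨ cong (_+ suc (length L′)) (ℕ.+-comm (length L) (suc c)) ⟩
      (suc c + length L) + suc (length L′)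
        ≡⟨ ℕ.+-assoc (suc c) (length L) _ ⟩
      suc c + (length L + suc (length L′))
        ≡⟨ cong (suc c +_) ∣L∣+∣L′∣ ⟩
      m₀ ∎

  φ-z : sumZ₂ (λ σ → φ σ ∧ z σ) ≡ true
  φ-z = trans (sumZ₂-single (λ σ → φ σ ∧ z σ) (face (suc zero)) others)
    (cong₂ _∧_ φ-face-one (delete-isFacet simplex (index (suc zero)) (∈-image index (suc zero))))
    where
    others : ∀ ρ → ρ ≢ face (suc zero) → φ ρ ∧ z ρ ≡ false
    others ρ ρ≢ with z ρ in eq
    ... | false = ∧-zeroʳ (φ ρ)
    ... | true with z-face ρ eq
    ...   | x , refl = trans (∧-identityʳ _) (φ-face-missing x (λ x≡1 → ρ≢ (cong face x≡1)))

  -- A cocycle pairs to zero with every boundary, but `φ` pairs to one with `z`.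
  z-not-boundary : ¬ IsBoundary K p z
  z-not-boundary (d , d-chain , ∂d≡z) = contradiction (begin
    true
      ≡⟨ sym φ-z ⟩
    sumZ₂ (λ σ → φ σ ∧ z σ)
      ≡⟨ sumZ₂-cong (λ σ → cong (φ σ ∧_) (sym (∂d≡z σ))) ⟩
    sumZ₂ (λ σ → φ σ ∧ boundary d σ)
      ≡⟨ ∑-facets-boundary φ d ⟩
    sumZ₂ (λ τ → d τ ∧ ∑-facets φ τ)
      ≡⟨ sumZ₂-false cocycle ⟩
    false ∎) (λ ())
    where
    open ≡-Reasoning
    cocycle : ∀ τ → d τ ∧ ∑-facets φ τ ≡ false
    cocycle τ with d τ in eq
    ... | false = refl
    -- A simplex of `d` lies in the neighbourhood complex; its common neighbour is what the cocycle
    -- property requires.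
    ... | true with proj₁ (d-chain τ (Equivalence.from T-≡ eq))
    ...   | _ , w , adj = weight-cocycle c e τ (e w) (λ i τi → adj i (lookup⇒[]= i τ τi))

  homology : HomologyNonzero K p
  homology = z , z-chain , z-cycle , z-not-boundary

-- Keeping `m` as a variable tied by an equation lets a match on `refl` replace a transport of `e`
-- along that equation.
homology-nonzero : ∀ c p m → suc (c + suc p) ≡ m → ∀ N (e : Fin N → Vec (Fin m) (suc (suc c))) → IsVertexEnumeration N e →
  HomologyNonzero (IsNbhdSimplex (λ a b → AdjG (e a) (e b))) p
homology-nonzero c p m refl N e enum = Sphere.homology c p N e enum

theorem4p19 : ∀ (m n : ℕ) → 3 ≤ n → n < m →
    ∀ (N : ℕ) (e : Fin N → Vec (Fin m) n) → IsVertexEnumeration N e →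
    HomologyNonzero (IsNbhdSimplex (λ a b → AdjG (e a) (e b))) (m ∸ n)
-- With `n = c + 2` and `p = m ∸ n`, the required equation is `n + p = m` after one successor is
-- moved.
theorem4p19 m (suc (suc c)) (s≤s (s≤s _)) n<m = homology-nonzero c (m ∸ suc (suc c)) m
  (trans (cong suc (ℕ.+-suc c _)) (ℕ.m+[n∸m]≡n (ℕ.<⇒≤ n<m)))
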